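{- For every positive integer $k$, let $G_{2k+1}$ be the Goldberg snark of order $8(2k+1)$. Then $$\Phi_c(G_{2k+1})\le 4+\frac{1}{k+1}.$$
   Context: For a real number $r\ge 2$, a circular nowhere-zero $r$-flow in a graph $G=(V,E)$ is an orientation of $G$ together with a function $f\colon E\to[1,r-1]$ such that at every vertex the sum of the values of incoming edges equals the sum of the values of outgoing edges. The circular flow number $\Phi_c(G)$ of a bridgeless graph $G$ is the least real $r$ such that $G$ admits a circular nowhere-zero $r$-flow (this minimum exists). The Goldberg snark $G_{2k+1}$ is the cubic graph obtained by cyclically gluing $2k+1$ copies of the Petersen graph minus two vertices at distance $2$. Explicitly, for each $t\in\mathbb{Z}/(2k+1)\mathbb{Z}$ take a block $P^-_t$ with eight vertices $z^t,w^t,w_1^t,w_2^t,x_1^t,x_2^t,y_1^t,y_2^t$ and the nine edges $$z^tw^t,\quad w^tw_1^t,\quad w^tw_2^t,\quad x_1^ty_1^t,\quad y_1^tw_1^t,\quad w_1^tx_2^t,\quad x_2^ty_2^t,\quad y_2^tw_2^t,\quad w_2^tx_1^t$$ (this is the Petersen graph minus two vertices $x,y$ at distance $2$, where $z$ is the common neighbour of $x$ and $y$, $x_1,x_2$ are the other neighbours of $x$, and $y_1,y_2$ are the other neighbours of $y$). Consecutive blocks $P^-_t$ and $P^-_{t+1}$ are joined by the three edges $z^tz^{t+1}$, $y_1^tx_1^{t+1}$, $y_2^tx_2^{t+1}$, with indices $t$ taken modulo $2k+1$. -}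

module Defs where

open import Algebra.Bundles using (AbelianGroup)
import Algebra.Properties.CommutativeSemigroup as CommutativeSemigroup
open import Data.Bool using (Bool; true; false; if_then_else_)
open import Data.Fin using (Fin; toℕ)
open import Data.Fin.Patterns
open import Data.Fin.Properties using (*↔×; inj⇒≟)
open import Data.Integer using (+_)
open import Data.Nat as ℕ using (ℕ; suc; NonZero; _⊔_)
import Data.Nat.Properties as ℕ
open import Data.Nat.DivMod using (_mod_)
open import Data.Product using (_×_; _,_; proj₁; proj₂; ∃-syntax; swap)
open import Data.Rational as ℚ using (ℚ; 0ℚ; 1ℚ; ½; ∣_∣)
import Data.Rational.Properties as ℚ
open import Data.Vec using (Vec; []; _∷_; lookup)
open import Data.Vec.Functional using (foldr)
open import Function using (_↔_; Inverse)
open import Function.Properties.Inverse using (↔-sym; ↔⇒↣)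
open import Relation.Binary.Definitions using (DecidableEquality)
open import Relation.Binary.PropositionalEquality using (_≡_; sym; cong; trans; subst)
open import Relation.Nullary.Decidable using (does)

-- The standard library has no reals; here a real is a Cauchy sequence of
-- rationals, and equality is the setoid equality _≃_ below.

record ℝ : Set where
  field
    seq    : ℕ → ℚ
    cauchy : ∀ ε → 0ℚ ℚ.< ε →
             ∃[ N ] (∀ m n → N ℕ.≤ m → N ℕ.≤ n → ∣ seq m ℚ.- seq n ∣ ℚ.≤ ε)

open ℝ public

infix 4 _≤_ _≃_

_≤_ : ℝ → ℝ → Set
x ≤ y = ∀ ε → 0ℚ ℚ.< ε → ∃[ N ] (∀ n → N ℕ.≤ n → seq x n ℚ.≤ seq y n ℚ.+ ε)

_≃_ : ℝ → ℝ → Set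
x ≃ y = x ≤ y × y ≤ x

fromℚ : ℚ → ℝ
fromℚ q = record
  { seq    = λ _ → q
  ; cauchy = λ ε 0<ε → 0 , λ _ _ _ _ →
      subst (λ p → ∣ p ∣ ℚ.≤ ε) (sym (ℚ.+-inverseʳ q)) (ℚ.<⇒≤ 0<ε)
  }

0ℝ 1ℝ 2ℝ : ℝ
0ℝ = fromℚ 0ℚ
1ℝ = fromℚ 1ℚ
2ℝ = fromℚ (+ 2 ℚ./ 1)

infixl 6 _+_ _-_
infix  8 -_

private
  half-pos : ∀ {ε} → 0ℚ ℚ.< ε → 0ℚ ℚ.< ½ ℚ.* ε
  half-pos = ℚ.*-monoʳ-<-pos ½

  halves : ∀ ε → ½ ℚ.* ε ℚ.+ ½ ℚ.* ε ≡ ε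
  halves ε = trans (sym (ℚ.*-distribʳ-+ ε ½ ½)) (ℚ.*-identityˡ ε)

  interchange : ∀ a b c d → (a ℚ.+ b) ℚ.- (c ℚ.+ d) ≡ (a ℚ.- c) ℚ.+ (b ℚ.- d)
  interchange a b c d = trans
    (cong ((a ℚ.+ b) ℚ.+_) (ℚ.neg-distrib-+ c d))
    (CommutativeSemigroup.interchange
      (AbelianGroup.commutativeSemigroup ℚ.+-0-abelianGroup) a b (ℚ.- c) (ℚ.- d))

_+_ : ℝ → ℝ → ℝ
x + y = record
  { seq    = λ n → seq x n ℚ.+ seq y n
  ; cauchy = λ ε 0<ε →
      let (M , p) = cauchy x (½ ℚ.* ε) (half-pos 0<ε)
          (N , q) = cauchy y (½ ℚ.* ε) (half-pos 0<ε)
          open ℚ.≤-Reasoning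
      in M ⊔ N , λ m n M⊔N≤m M⊔N≤n → begin
        ∣ (seq x m ℚ.+ seq y m) ℚ.- (seq x n ℚ.+ seq y n) ∣
          ≡⟨ cong ∣_∣ (interchange (seq x m) (seq y m) (seq x n) (seq y n)) ⟩
        ∣ (seq x m ℚ.- seq x n) ℚ.+ (seq y m ℚ.- seq y n) ∣
          ≤⟨ ℚ.∣p+q∣≤∣p∣+∣q∣ (seq x m ℚ.- seq x n) (seq y m ℚ.- seq y n) ⟩
        ∣ seq x m ℚ.- seq x n ∣ ℚ.+ ∣ seq y m ℚ.- seq y n ∣
          ≤⟨ ℚ.+-mono-≤ (p m n (ℕ.m⊔n≤o⇒m≤o M N M⊔N≤m) (ℕ.m⊔n≤o⇒m≤o M N M⊔N≤n))
                        (q m n (ℕ.m⊔n≤o⇒n≤o M N M⊔N≤m) (ℕ.m⊔n≤o⇒n≤o M N M⊔N≤n)) ⟩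
        ½ ℚ.* ε ℚ.+ ½ ℚ.* ε
          ≡⟨ halves ε ⟩
        ε ∎
  }

-_ : ℝ → ℝ
- x = record
  { seq    = λ n → ℚ.- seq x n
  ; cauchy = λ ε 0<ε →
      let (N , p) = cauchy x ε 0<ε
      in N , λ m n N≤m N≤n →
        subst (ℚ._≤ ε)
              (trans (sym (ℚ.∣-p∣≡∣p∣ (seq x m ℚ.- seq x n)))
                     (cong ∣_∣ (ℚ.neg-distrib-+ (seq x m) (ℚ.- seq x n))))
              (p m n N≤m N≤n)
  }

_-_ : ℝ → ℝ → ℝ
x - y = x + (- y)

-- The order of the two components of ends e carries no meaning: it only
-- serves as a reference for describing orientations.

record Graph : Set₁ where
  field
    V E   : Set
    order : ℕ
    size  : ℕ
    V↔Fin : V ↔ Fin order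
    E↔Fin : E ↔ Fin size
    ends  : E → V × V

  infix 4 _≟_

  _≟_ : DecidableEquality V
  _≟_ = inj⇒≟ (↔⇒↣ V↔Fin)

  ∑ₑ : (E → ℝ) → ℝ
  ∑ₑ h = foldr _+_ 0ℝ (λ i → h (Inverse.from E↔Fin i))

  -- true keeps the reference order (tail , head), false reverses it.
  Orientation : Set
  Orientation = E → Bool

  arc : Orientation → E → V × V
  arc o e = if o e then ends e else swap (ends e)

  tail head : Orientation → E → V
  tail o e = proj₁ (arc o e)
  head o e = proj₂ (arc o e)

  inflow outflow : Orientation → (E → ℝ) → V → ℝ
  inflow  o f v = ∑ₑ (λ e → if does (head o e ≟ v) then f e else 0ℝ)
  outflow o f v = ∑ₑ (λ e → if does (tail o e ≟ v) then f e else 0ℝ)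

record CircularNowhereZeroFlow (G : Graph) (r : ℝ) : Set where
  open Graph G
  field
    orientation  : Orientation
    value        : E → ℝ
    value-lower  : ∀ e → 1ℝ ≤ value e
    value-upper  : ∀ e → value e ≤ r - 1ℝ
    conservation : ∀ v → inflow orientation value v ≃ outflow orientation value v

-- IsCircularFlowNumber G φ expresses Φ_c(G) = φ.  For a graph with a bridge
-- no φ satisfies it.

record IsCircularFlowNumber (G : Graph) (φ : ℝ) : Set where
  field
    2≤φ      : 2ℝ ≤ φ
    attained : CircularNowhereZeroFlow G φ
    least    : ∀ r → 2ℝ ≤ r → CircularNowhereZeroFlow G r → φ ≤ r

-- The cyclic gluing of n blocks, where a vertex is a pair of a block index
-- and a position in the block.  It is a Goldberg snark when n ≥ 3 is odd.

module Goldberg (n : ℕ) .{{_ : NonZero n}} where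

  pattern z  = 0F
  pattern w  = 1F
  pattern w₁ = 2F
  pattern w₂ = 3F
  pattern x₁ = 4F
  pattern x₂ = 5F
  pattern y₁ = 6F
  pattern y₂ = 7F

  Vertex : Set
  Vertex = Fin n × Fin 8

  infix 8 _at_
  infix 6 _—_

  _at_ : Fin 8 → Fin n → Vertex
  v at t = t , v

  _—_ : Vertex → Vertex → Vertex × Vertex
  u — v = u , v

  next : Fin n → Fin n
  next t = suc (toℕ t) mod n

  -- The nine edges inside block t, then the three joining it to block t + 1.
  edges : Fin n → Vec (Vertex × Vertex) 12
  edges t =
    z  at t — w  at t ∷
    w  at t — w₁ at t ∷
    w  at t — w₂ at t ∷
    x₁ at t — y₁ at t ∷
    y₁ at t — w₁ at t ∷
    w₁ at t — x₂ at t ∷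
    x₂ at t — y₂ at t ∷
    y₂ at t — w₂ at t ∷
    w₂ at t — x₁ at t ∷
    z  at t — z  at next t ∷
    y₁ at t — x₁ at next t ∷
    y₂ at t — x₂ at next t ∷
    []

  graph : Graph
  graph = record
    { V     = Vertex
    ; E     = Fin n × Fin 12
    ; order = n ℕ.* 8
    ; size  = n ℕ.* 12
    ; V↔Fin = ↔-sym *↔×
    ; E↔Fin = ↔-sym *↔×
    ; ends  = λ (t , e) → lookup (edges t) e
    }

-- Indexed by k, where the number of blocks is 2k+1.
goldbergSnark : ℕ → Graph
goldbergSnark k = Goldberg.graph (suc (2 ℕ.* k))

{-# OPTIONS --safe #-}
module Submission where

-- Multiplied by q = k + 1, the required flow takes integer values in
-- [q , 3q + 1]; a flow with these values is then compared with the minimum.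
-- In the flow below every joining edge points from block t to block t + 1, so
-- the flow is a closed walk through the triples carried by the three joins, and
-- each block must conserve the flow between two consecutive triples. A pair
-- of blocks A, B moves the triple X(i , j), affine in i and j, to X(i - 1 , j + 1);
-- starting from X(k - 1 , 0), k - 1 such pairs lead to X(0 , k - 1), and three
-- more blocks C₁, C₂, C₃ lead back, which gives 2(k - 1) + 3 = 2k + 1 blocks.
-- Conservation and the bounds for affine functions are conditions on their
-- coefficients, so each of the five blocks is checked by computation.

open import Defs
open import Algebra.Bundles using (RawMonoid)
import Algebra.Construct.DirectProduct as DirectProduct
open import Algebra.Definitions.RawMonoid using (sum)
open import Algebra.Properties.CommutativeMonoid.Sum using
  (∑-distrib-+; sum-cong-≗; sum-replicate-zero)
open import Data.Bool using (Bool; true; false; if_then_else_; _∧_)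
open import Data.Bool.Properties using (if-float)
open import Data.Fin as Fin using (Fin; zero; suc; toℕ; fromℕ; inject₁; splitAt; remQuot; _↑ˡ_; _↑ʳ_)
open import Data.Fin.Patterns
open import Data.Fin.Properties using
  (all?; splitAt-↑ˡ; splitAt-↑ʳ; toℕ-injective; toℕ-fromℕ<; toℕ-fromℕ; toℕ-inject₁; toℕ<n)
open import Data.Fin.Relation.Unary.Top using (view; ‵fromℕ; ‵inject₁)
open import Data.Integer as ℤ using (+_)
import Data.Integer.Properties as ℤ
import Data.Integer.Tactic.RingSolver as ℤ
open import Data.Nat as ℕ using (ℕ; zero; suc; NonZero)
open import Data.Nat.DivMod using (_%_; n%n≡0; m<n⇒m%n≡m)
import Data.Nat.Properties as ℕ
open import Data.Nat.Tactic.RingSolver using (solve-∀)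
open import Data.Product using (_×_; _,_; proj₁; proj₂; swap)
open import Data.Product.Properties using (≡-dec)
open import Data.Rational as ℚ using (ℚ; _/_; 0ℚ; 1ℚ)
import Data.Rational.Properties as ℚ
import Data.Rational.Unnormalised as ℚᵘ
import Data.Rational.Unnormalised.Properties as ℚᵘ
open import Data.Sum using (inj₁; inj₂; [_,_]′)
open import Data.Vec using (Vec; []; _∷_; lookup; map)
open import Data.Vec.Properties using (lookup-map; map-∘; map-cong)
open import Function using (_∘_; id; const; Inverse; mk⇔)
open import Level using (0ℓ)
open import Relation.Binary.PropositionalEquality
open import Relation.Nullary using (Dec; does; contradiction)
open import Relation.Nullary.Decidable using (_×-dec_; from-yes; does-⇔; dec-true; dec-false)

open Goldberg 1 using (z; w; w₁; w₂; x₁; x₂; y₁; y₂)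

-- Sums selected by Boolean tests, over raw monoids.

ℕ-monoid ℚ-monoid ℝ-monoid : RawMonoid 0ℓ 0ℓ
ℕ-monoid = ℕ.+-0-rawMonoid
ℚ-monoid = ℚ.+-0-rawMonoid
ℝ-monoid = record { Carrier = ℝ ; _≈_ = _≃_ ; _∙_ = _+_ ; ε = 0ℝ }

ℕ-commutativeMonoid = ℕ.+-0-commutativeMonoid

module _ (M : RawMonoid 0ℓ 0ℓ) where
  open RawMonoid M

  -- Over `ℝ-monoid` this unfolds to the sums in `inflow` and `outflow`. A raw monoid suffices as
  -- parameter, so reals, with laws only up to `_≃_`, are covered along with `ℕ`, `ℚ` and affine
  -- forms.
  collect : ∀ {n} → (Fin n → Bool) → (Fin n → Carrier) → Carrier
  collect b f = sum M λ i → if b i then f i else ε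

-- Transfers sums along three maps: affine forms to `ℕ` by evaluation, `ℕ` to `ℚ` by scaling, and
-- `ℝ` to `ℚ` by taking a term of the sequence.
collect-homo : ∀ (M N : RawMonoid 0ℓ 0ℓ) (let module M = RawMonoid M; module N = RawMonoid N)
  (h : M.Carrier → N.Carrier) → h M.ε ≡ N.ε → (∀ a b → h (a M.∙ b) ≡ h a N.∙ h b) →
  ∀ {n} (b : Fin n → Bool) f → h (collect M b f) ≡ collect N b (h ∘ f)
collect-homo M N h h-ε h-∙ {zero}  b f = h-ε
collect-homo M N h h-ε h-∙ {suc n} b f = trans (h-∙ _ _)
  (cong₂ (RawMonoid._∙_ N)
    (trans (if-float h (b zero)) (cong (if b zero then h (f zero) else_) h-ε))
    (collect-homo M N h h-ε h-∙ (b ∘ suc) (f ∘ suc)))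

sumℕ : ∀ {n} → (Fin n → ℕ) → ℕ
sumℕ = sum ℕ-monoid

sumℕ-cong : ∀ {n} {f g : Fin n → ℕ} → (∀ i → f i ≡ g i) → sumℕ f ≡ sumℕ g
sumℕ-cong = sum-cong-≗ ℕ-commutativeMonoid

sumℕ-++ : ∀ m {n} (f : Fin (m ℕ.+ n) → ℕ) →
  sumℕ f ≡ sumℕ (f ∘ (_↑ˡ n)) ℕ.+ sumℕ (f ∘ (m ↑ʳ_))
sumℕ-++ zero    f = refl
sumℕ-++ (suc m) f = trans (cong (f zero ℕ.+_) (sumℕ-++ m (f ∘ suc))) (sym (ℕ.+-assoc (f zero) _ _))

-- The graph enumerates its edges through `remQuot`, so this regroups a sum over all edges block by
-- block.
sumℕ-remQuot : ∀ m n (g : Fin m × Fin n → ℕ) →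
  sumℕ (g ∘ remQuot {m} n) ≡ sumℕ λ i → sumℕ λ j → g (i , j)
sumℕ-remQuot zero    n g = refl
sumℕ-remQuot (suc m) n g = trans (sumℕ-++ n (g ∘ remQuot {suc m} n)) (cong₂ ℕ._+_
  (sumℕ-cong λ j → cong g (remQuot-↑ˡ j))
  (trans (sumℕ-cong λ i → cong g (remQuot-↑ʳ i)) (sumℕ-remQuot m n (λ (i , j) → g (suc i , j)))))
  where
  remQuot-↑ˡ : ∀ j → remQuot {suc m} n (j ↑ˡ (m ℕ.* n)) ≡ (zero , j)
  remQuot-↑ˡ j rewrite splitAt-↑ˡ n j (m ℕ.* n) = refl
  remQuot-↑ʳ : ∀ i → remQuot {suc m} n (n ↑ʳ i) ≡ (suc (proj₁ (remQuot {m} n i)) , proj₂ (remQuot {m} n i))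
  remQuot-↑ʳ i rewrite splitAt-↑ʳ n (m ℕ.* n) i = refl

collect-false : ∀ {n} (b : Fin n → Bool) f → (∀ i → b i ≡ false) → collect ℕ-monoid b f ≡ 0
collect-false {n} b f b-false = trans
  (sumℕ-cong λ i → cong (if_then f i else 0) (b-false i))
  (sum-replicate-zero ℕ-commutativeMonoid n)

collect-single : ∀ {n} (b : Fin n → Bool) f i → b i ≡ true → (∀ j → j ≢ i → b j ≡ false) →
  collect ℕ-monoid b f ≡ f i
collect-single b f zero    bi others rewrite bi =
  trans (cong (f zero ℕ.+_) (collect-false (b ∘ suc) (f ∘ suc) λ j → others (suc j) λ ()))
        (ℕ.+-identityʳ (f zero))
collect-single b f (suc i) bi others rewrite others zero (λ ()) =
  collect-single (b ∘ suc) (f ∘ suc) i bi λ j j≢i → others (suc j) λ { refl → j≢i refl }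

collect-∧ : ∀ {n} b (c : Fin n → Bool) f →
  collect ℕ-monoid (λ i → b ∧ c i) f ≡ (if b then collect ℕ-monoid c f else 0)
collect-∧ true  c f = refl
collect-∧ {n} false c f = sum-replicate-zero ℕ-commutativeMonoid n

-- Conservation inside a single block.

-- The edges of a block with block indices stripped. They no longer depend on the number of blocks,
-- which makes balance checkable by computation.
localEnds : Vec (Fin 8 × Fin 8) 9
localEnds =
  (z , w) ∷ (w , w₁) ∷ (w , w₂) ∷ (x₁ , y₁) ∷ (y₁ , w₁) ∷
  (w₁ , x₂) ∷ (x₂ , y₂) ∷ (y₂ , w₂) ∷ (w₂ , x₁) ∷ []

joinEnds : Vec (Fin 8 × Fin 8) 3
joinEnds = (z , z) ∷ (y₁ , x₁) ∷ (y₂ , x₂) ∷ []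

inner : Fin 9 → Fin 12
inner = _↑ˡ 3

joining : Fin 3 → Fin 12
joining = 9 ↑ʳ_

localArc : Bool → Fin 9 → Fin 8 × Fin 8
localArc d e = if d then lookup localEnds e else swap (lookup localEnds e)

localAt : (Fin 8 × Fin 8 → Fin 8) → Fin 8 → (Fin 9 → Bool) → Fin 9 → Bool
localAt end p d e = does (end (localArc (d e) e) Fin.≟ p)

joinAt : (Fin 8 × Fin 8 → Fin 8) → Fin 8 → Fin 3 → Bool
joinAt end p e = does (end (lookup joinEnds e) Fin.≟ p)

module _ (M : RawMonoid 0ℓ 0ℓ) where
  open RawMonoid M

  -- With `end = proj₂` this is the flow into position `p`, and `x` is the received triple; with
  -- `end = proj₁` it is the flow out, and `x` is the emitted one.
  incident : (Fin 8 × Fin 8 → Fin 8) → Fin 8 →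
    (Fin 9 → Bool) → (Fin 9 → Carrier) → (Fin 3 → Carrier) → Carrier
  incident end p d f x = collect M (localAt end p d) f ∙ collect M (joinAt end p) x

  -- All the joining edges are directed from block t to block t + 1: the block
  -- receives x and emits x′ on them.
  Balanced : (Fin 9 → Bool) → (Fin 9 → Carrier) → (x x′ : Fin 3 → Carrier) → Set
  Balanced d f x x′ = ∀ p → incident proj₂ p d f x ≡ incident proj₁ p d f x′

incident-homo : ∀ (M N : RawMonoid 0ℓ 0ℓ) (let module M = RawMonoid M; module N = RawMonoid N)
  (h : M.Carrier → N.Carrier) → h M.ε ≡ N.ε → (∀ a b → h (a M.∙ b) ≡ h a N.∙ h b) →
  ∀ end p d f x → h (incident M end p d f x) ≡ incident N end p d (h ∘ f) (h ∘ x)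
incident-homo M N h h-ε h-∙ end p d f x = trans (h-∙ _ _)
  (cong₂ (RawMonoid._∙_ N)
    (collect-homo M N h h-ε h-∙ (localAt end p d) f)
    (collect-homo M N h h-ε h-∙ (joinAt end p) x))

incident-cong : ∀ end p d f {x y : Fin 3 → ℕ} → (∀ e → x e ≡ y e) →
  incident ℕ-monoid end p d f x ≡ incident ℕ-monoid end p d f y
incident-cong end p d f x≗y = cong (collect ℕ-monoid (localAt end p d) f ℕ.+_)
  (sumℕ-cong λ e → cong (if joinAt end p e then_else 0) (x≗y e))

-- The cyclic predecessor of a block.

prev : ∀ {n} → Fin (suc n) → Fin (suc n)
prev zero    = fromℕ _
prev (suc t) = inject₁ t

module _ {n : ℕ} where
  open Goldberg (suc n) using (next)

  next-inject₁ : ∀ (t : Fin n) → next (inject₁ t) ≡ suc t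
  next-inject₁ t = toℕ-injective (trans (toℕ-fromℕ< _)
    (trans (cong (λ i → suc i % suc n) (toℕ-inject₁ t)) (m<n⇒m%n≡m (ℕ.s≤s (toℕ<n t)))))

  next-fromℕ : next (fromℕ n) ≡ zero
  next-fromℕ = toℕ-injective (trans (toℕ-fromℕ< _)
    (trans (cong (λ i → suc i % suc n) (toℕ-fromℕ n)) (n%n≡0 (suc n))))

  next-prev : ∀ t → next (prev t) ≡ t
  next-prev zero    = next-fromℕ
  next-prev (suc t) = next-inject₁ t

  prev-next : ∀ t → prev (next t) ≡ t
  prev-next t with view t
  ... | ‵fromℕ     rewrite next-fromℕ = refl
  ... | ‵inject₁ i rewrite next-inject₁ i = refl

-- Gluing balanced blocks into a flow on the whole graph.

module Assembly {n : ℕ}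
  (d : Fin (suc n) → Fin 9 → Bool) (f : Fin (suc n) → Fin 9 → ℕ)
  (x x′ : Fin (suc n) → Fin 3 → ℕ)
  (x′-prev : ∀ t e → x′ (prev t) e ≡ x t e)
  (balanced : ∀ t → Balanced ℕ-monoid (d t) (f t) (x t) (x′ t))
  where

  open Goldberg (suc n) using (next; Vertex)
  open Graph (Goldberg.graph (suc n)) using (Orientation; ends; arc; E↔Fin) renaming (_≟_ to _≟ⱽ_)

  orientation : Orientation
  orientation (t , e) = [ d t , const true ]′ (splitAt 9 e)

  amount : Fin (suc n) × Fin 12 → ℕ
  amount (t , e) = [ f t , x′ t ]′ (splitAt 9 e)

  ends-inner : ∀ t e → ends (t , inner e) ≡
    -- The edge has to be a concrete index before the two lookups reduce, hence nine cases.
    ((t , proj₁ (lookup localEnds e)) , (t , proj₂ (lookup localEnds e)))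
  ends-inner t 0F = refl
  ends-inner t 1F = refl
  ends-inner t 2F = refl
  ends-inner t 3F = refl
  ends-inner t 4F = refl
  ends-inner t 5F = refl
  ends-inner t 6F = refl
  ends-inner t 7F = refl
  ends-inner t 8F = refl

  arc-local : ∀ t e → arc orientation (t , inner e) ≡
    ((t , proj₁ (localArc (d t e) e)) , (t , proj₂ (localArc (d t e) e)))
  arc-local t e rewrite splitAt-↑ˡ 9 e 3 | ends-inner t e with d t e
  ... | true  = refl
  ... | false = refl

  arc-join : ∀ t e → arc orientation (t , joining e) ≡
    ((t , proj₁ (lookup joinEnds e)) , (next t , proj₂ (lookup joinEnds e)))
  arc-join t 0F = refl
  arc-join t 1F = refl
  arc-join t 2F = refl

  amount-local : ∀ t e → amount (t , inner e) ≡ f t e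
  amount-local t e rewrite splitAt-↑ˡ 9 e 3 = refl

  amount-join : ∀ t e → amount (t , joining e) ≡ x′ t e
  amount-join t e rewrite splitAt-↑ʳ 9 3 e = refl

  -- The graph compares vertices through their codes in `Fin`; equivalent propositions have equal
  -- decisions, so a coordinatewise test may replace this.
  does-≟ⱽ : ∀ s p t q → does ((s , p) ≟ⱽ (t , q)) ≡ does (s Fin.≟ t) ∧ does (p Fin.≟ q)
  does-≟ⱽ s p t q = does-⇔ (mk⇔ (λ { refl → refl , refl }) (λ { (refl , refl) → refl }))
    ((s , p) ≟ⱽ (t , q)) (s Fin.≟ t ×-dec p Fin.≟ q)

  flowℕ : (Vertex × Vertex → Vertex) → Vertex → ℕ
  flowℕ end v = collect ℕ-monoid
    (λ i → does (end (arc orientation (Inverse.from E↔Fin i)) ≟ⱽ v))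
    (amount ∘ Inverse.from E↔Fin)

  -- One statement for heads and tails: `place s` is the block containing the chosen end of the
  -- joins leaving block `s`, and `source` is its inverse. Hence only the inner edges of block `t`
  -- and the joins leaving block `source t` contribute.
  flow-at : (end : Vertex × Vertex → Vertex) (end′ : Fin 8 × Fin 8 → Fin 8)
    (place source : Fin (suc n) → Fin (suc n)) →
    (∀ s e → end (arc orientation (s , inner e)) ≡ (s , end′ (localArc (d s e) e))) →
    (∀ s e → end (arc orientation (s , joining e)) ≡ (place s , end′ (lookup joinEnds e))) →
    (∀ t → place (source t) ≡ t) → (∀ s → source (place s) ≡ s) →
    ∀ t p → flowℕ end (t , p) ≡ incident ℕ-monoid end′ p (d t) (f t) (x′ (source t))
  flow-at end end′ place source end-local end-join place-source source-place t p = begin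
    flowℕ end (t , p)
      ≡⟨ sumℕ-remQuot (suc n) 12 term ⟩
    sumℕ (λ s → sumℕ λ e → term (s , e))
      ≡⟨ sumℕ-cong (λ s → trans (sumℕ-++ 9 {3} (λ e → term (s , e)))
           (cong₂ ℕ._+_ {x = sumℕ λ e → term (s , inner e)} (local-terms s) (join-terms s))) ⟩
    sumℕ (λ s → local s ℕ.+ join s)
      ≡⟨ ∑-distrib-+ ℕ-commutativeMonoid local join ⟩
    sumℕ local ℕ.+ sumℕ join
      ≡⟨ cong₂ ℕ._+_
           (collect-single (λ s → does (s Fin.≟ t)) localSum t (dec-true (t Fin.≟ t) refl)
             (λ s s≢t → dec-false (s Fin.≟ t) s≢t))
           (collect-single (λ s → does (place s Fin.≟ t)) joinSum (source t)
             (dec-true (place (source t) Fin.≟ t) (place-source t))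
             (λ s s≢ → dec-false (place s Fin.≟ t)
               λ ps≡t → s≢ (trans (sym (source-place s)) (cong source ps≡t)))) ⟩
    incident ℕ-monoid end′ p (d t) (f t) (x′ (source t)) ∎
    where
    open ≡-Reasoning
    term : Fin (suc n) × Fin 12 → ℕ
    term e = if does (end (arc orientation e) ≟ⱽ (t , p)) then amount e else 0

    localSum joinSum local join : Fin (suc n) → ℕ
    localSum s = collect ℕ-monoid (localAt end′ p (d s)) (f s)
    joinSum s = collect ℕ-monoid (joinAt end′ p) (x′ s)
    local s = if does (s Fin.≟ t) then localSum s else 0
    join s = if does (place s Fin.≟ t) then joinSum s else 0

    term-≡ : ∀ e {s q m} → end (arc orientation e) ≡ (s , q) → amount e ≡ m →
      term e ≡ (if does (s Fin.≟ t) ∧ does (q Fin.≟ p) then m else 0)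
    term-≡ e {s} {q} end≡ amount≡ = cong₂ (if_then_else 0)
      (trans (cong (λ v → does (v ≟ⱽ (t , p))) end≡) (does-≟ⱽ s q t p)) amount≡

    local-terms : ∀ s → sumℕ (λ e → term (s , inner e)) ≡ local s
    local-terms s = trans
      (sumℕ-cong λ e → term-≡ (s , inner e) (end-local s e) (amount-local s e))
      (collect-∧ (does (s Fin.≟ t)) (localAt end′ p (d s)) (f s))

    join-terms : ∀ s → sumℕ (λ e → term (s , joining e)) ≡ join s
    join-terms s = trans
      (sumℕ-cong {3} λ e → term-≡ (s , joining e) (end-join s e) (amount-join s e))
      (collect-∧ (does (place s Fin.≟ t)) (joinAt end′ p) (x′ s))

  conservation : ∀ v → flowℕ proj₂ v ≡ flowℕ proj₁ v
  conservation (t , p) = begin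
    flowℕ proj₂ (t , p)
      ≡⟨ flow-at proj₂ proj₂ next prev (λ s e → cong proj₂ (arc-local s e))
           (λ s e → cong proj₂ (arc-join s e)) next-prev prev-next t p ⟩
    incident ℕ-monoid proj₂ p (d t) (f t) (x′ (prev t))
      ≡⟨ incident-cong proj₂ p (d t) (f t) (x′-prev t) ⟩
    incident ℕ-monoid proj₂ p (d t) (f t) (x t)
      ≡⟨ balanced t p ⟩
    incident ℕ-monoid proj₁ p (d t) (f t) (x′ t)
      ≡⟨ flow-at proj₁ proj₁ id id (λ s e → cong proj₁ (arc-local s e))
           (λ s e → cong proj₁ (arc-join s e)) (λ _ → refl) (λ _ → refl) t p ⟨
    flowℕ proj₁ (t , p) ∎
    where open ≡-Reasoning

-- Blocks with bounded values and chains of blocks.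

Admissible : ℕ → ℕ → Set
Admissible q m = q ℕ.≤ m × m ℕ.≤ 3 ℕ.* q ℕ.+ 1

-- Only the emitted triple is bounded: around a closed chain, every received triple is emitted by
-- the preceding block.
record Block (q : ℕ) (s s′ : Vec ℕ 3) : Set where
  field
    direction        : Fin 9 → Bool
    value            : Fin 9 → ℕ
    balanced         : Balanced ℕ-monoid direction value (lookup s) (lookup s′)
    value-admissible : ∀ e → Admissible q (value e)
    join-admissible  : ∀ e → Admissible q (lookup s′ e)

open Block

data Chain (q : ℕ) : ℕ → Vec ℕ 3 → Vec ℕ 3 → Set where
  []  : ∀ {s} → Chain q 0 s s
  _∷_ : ∀ {n s s′ s″} → Block q s s′ → Chain q n s′ s″ → Chain q (suc n) s s″

module _ {q : ℕ} where

  before after : ∀ {n s s′} → Chain q n s s′ → Fin n → Vec ℕ 3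
  before {s = s} (_ ∷ _) zero    = s
  before         (_ ∷ c) (suc t) = before c t
  after (_∷_ {s′ = s′} _ _) zero = s′
  after (_ ∷ c) (suc t)          = after c t

  block : ∀ {n s s′} (c : Chain q n s s′) t → Block q (before c t) (after c t)
  block (b ∷ _) zero    = b
  block (_ ∷ c) (suc t) = block c t

  before-zero : ∀ {n s s′} (c : Chain q (suc n) s s′) → before c zero ≡ s
  before-zero (_ ∷ _) = refl

  after-fromℕ : ∀ {n s s′} (c : Chain q (suc n) s s′) → after c (fromℕ n) ≡ s′
  after-fromℕ (_ ∷ [])          = refl
  after-fromℕ (_ ∷ c@(_ ∷ _)) = after-fromℕ c

  after-inject₁ : ∀ {n s s′} (c : Chain q (suc n) s s′) t → after c (inject₁ t) ≡ before c (suc t)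
  after-inject₁ (_ ∷ (_ ∷ _))     zero    = refl
  after-inject₁ (_ ∷ c@(_ ∷ _)) (suc t) = after-inject₁ c t

  -- Closedness enters at `zero`, whose predecessor is the last block; elsewhere consecutive blocks
  -- of the chain share a triple.
  after-prev : ∀ {n s} (c : Chain q (suc n) s s) t → after c (prev t) ≡ before c t
  after-prev c zero    = trans (after-fromℕ c) (sym (before-zero c))
  after-prev c (suc t) = after-inject₁ c t

-- Affine forms in two natural parameters.

Form : Set
Form = ℕ × ℕ × ℕ

Form-monoid : RawMonoid 0ℓ 0ℓ
Form-monoid = DirectProduct.rawMonoid ℕ-monoid (DirectProduct.rawMonoid ℕ-monoid ℕ-monoid)

eval : ℕ → ℕ → Form → ℕ
eval i j (v , a , b) = v ℕ.+ (i ℕ.* a ℕ.+ j ℕ.* b)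

eval-zero : ∀ i j → eval i j (0 , 0 , 0) ≡ 0
eval-zero i j = cong₂ ℕ._+_ (ℕ.*-zeroʳ i) (ℕ.*-zeroʳ j)

eval-homo : ∀ i j f g → eval i j (RawMonoid._∙_ Form-monoid f g) ≡ eval i j f ℕ.+ eval i j g
eval-homo i j (v , a , b) (v′ , a′ , b′) = lemma i j v a b v′ a′ b′
  where
  lemma : ∀ i j v a b v′ a′ b′ →
    (v ℕ.+ v′) ℕ.+ (i ℕ.* (a ℕ.+ a′) ℕ.+ j ℕ.* (b ℕ.+ b′)) ≡
    (v ℕ.+ (i ℕ.* a ℕ.+ j ℕ.* b)) ℕ.+ (v′ ℕ.+ (i ℕ.* a′ ℕ.+ j ℕ.* b′))
  lemma = solve-∀

-- Comparing coefficients is decidable and implies the inequality for all `i` and `j`, since these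
-- are natural numbers.
_≼_ : Form → Form → Set
(v , a , b) ≼ (v′ , a′ , b′) = v ℕ.≤ v′ × a ℕ.≤ a′ × b ℕ.≤ b′

_≼?_ : ∀ f g → Dec (f ≼ g)
(v , a , b) ≼? (v′ , a′ , b′) = v ℕ.≤? v′ ×-dec a ℕ.≤? a′ ×-dec b ℕ.≤? b′

eval-mono : ∀ i j {f g} → f ≼ g → eval i j f ℕ.≤ eval i j g
eval-mono i j (v≤ , a≤ , b≤) =
  ℕ.+-mono-≤ v≤ (ℕ.+-mono-≤ (ℕ.*-monoʳ-≤ i a≤) (ℕ.*-monoʳ-≤ j b≤))

module _ (lo hi : Form) (edges : Vec (Bool × Form) 9) (s s′ : Vec Form 3) where

  Correct : Set
  Correct =
    Balanced Form-monoid (proj₁ ∘ lookup edges) (proj₂ ∘ lookup edges) (lookup s) (lookup s′) ×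
    (∀ e → lo ≼ proj₂ (lookup edges e) × proj₂ (lookup edges e) ≼ hi) ×
    (∀ e → lo ≼ lookup s′ e × lookup s′ e ≼ hi)

  correct? : Dec Correct
  correct? =
    all? (λ p → ≡-dec ℕ._≟_ (≡-dec ℕ._≟_ ℕ._≟_) _ _) ×-dec
    all? (λ e → lo ≼? _ ×-dec _ ≼? hi) ×-dec
    all? (λ e → lo ≼? _ ×-dec _ ≼? hi)

record Template (lo hi : Form) (s s′ : Vec Form 3) : Set where
  constructor template
  field
    edges   : Vec (Bool × Form) 9
    correct : Correct lo hi edges s s′

-- Evaluation is additive, so balance carries over from forms to numbers, and monotone, so the
-- bounds do. The last two premises say that `lo` and `hi` evaluate to the ends of the admissible
-- interval.
instantiate : ∀ {lo hi s s′ q} i j → Template lo hi s s′ →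
  eval i j lo ≡ q → eval i j hi ≡ 3 ℕ.* q ℕ.+ 1 →
  Block q (map (eval i j) s) (map (eval i j) s′)
instantiate {lo} {hi} {s} {s′} {q} i j (template edges (balanced , edges-≼ , s′-≼)) lo≡ hi≡ = record
  { direction        = dir
  ; value            = eval i j ∘ form
  ; balanced         = λ p → begin
      incident ℕ-monoid proj₂ p dir (eval i j ∘ form) (lookup (map (eval i j) s))
        ≡⟨ eval-incident proj₂ p s ⟨
      eval i j (incident Form-monoid proj₂ p dir form (lookup s))
        ≡⟨ cong (eval i j) (balanced p) ⟩
      eval i j (incident Form-monoid proj₁ p dir form (lookup s′))
        ≡⟨ eval-incident proj₁ p s′ ⟩
      incident ℕ-monoid proj₁ p dir (eval i j ∘ form) (lookup (map (eval i j) s′)) ∎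
  ; value-admissible = λ e → admissible (edges-≼ e)
  ; join-admissible  = λ e → subst (Admissible q) (sym (lookup-map e (eval i j) s′)) (admissible (s′-≼ e))
  }
  where
  open ≡-Reasoning
  dir : Fin 9 → Bool
  dir = proj₁ ∘ lookup edges

  form : Fin 9 → Form
  form = proj₂ ∘ lookup edges

  admissible : ∀ {f} → lo ≼ f × f ≼ hi → Admissible q (eval i j f)
  admissible {f} (lo≼f , f≼hi) =
    subst (ℕ._≤ eval i j f) lo≡ (eval-mono i j lo≼f) ,
    subst (eval i j f ℕ.≤_) hi≡ (eval-mono i j f≼hi)

  eval-incident : ∀ end p (x : Vec Form 3) →
    eval i j (incident Form-monoid end p dir form (lookup x)) ≡
    incident ℕ-monoid end p dir (eval i j ∘ form) (lookup (map (eval i j) x))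
  eval-incident end p x = trans
    (incident-homo Form-monoid ℕ-monoid (eval i j) (eval-zero i j) (eval-homo i j) end p dir form (lookup x))
    (incident-cong end p dir (eval i j ∘ form) λ e → sym (lookup-map e (eval i j) x))

-- The five explicit blocks and the closed walk.

-- The triples and the blocks were found by a computer search. In A and B,
-- i + j = q - 3; in the blocks C, i = 0 and j = q - 2. Hence the bounds q and
-- 3q + 1 are the forms (3 , 1 , 1) and (10 , 3 , 3), respectively (2 , 0 , 1)
-- and (7 , 0 , 3).
X Y X₁ X₂ : Vec Form 3
X = (5 , 2 , 3) ∷ (5 , 2 , 2) ∷ (3 , 2 , 1) ∷ []
Y = (4 , 1 , 2) ∷ (9 , 3 , 3) ∷ (6 , 2 , 1) ∷ []
X₁ = (3 , 0 , 2) ∷ (3 , 0 , 1) ∷ (7 , 0 , 3) ∷ []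
X₂ = (7 , 0 , 3) ∷ (4 , 0 , 2) ∷ (2 , 0 , 1) ∷ []

-- Substitutions in a form: `shift₁` and `shift₂` replace `i` by `i + 1` and `j` by `j + 1`; `drop₁`
-- sets `i = 0`; `drop₂` sets `j = 0` and then renames `i` to `j`.
shift₁ shift₂ drop₁ drop₂ : Form → Form
shift₁ (v , a , b) = v ℕ.+ a , a , b
shift₂ (v , a , b) = v ℕ.+ b , a , b
drop₁ (v , a , b) = v , 0 , b
drop₂ (v , a , b) = v , 0 , a

pattern forward  f = (true , f)
pattern backward f = (false , f)

A-edges B-edges C₁-edges C₂-edges C₃-edges : Vec (Bool × Form) 9
A-edges =
  forward (3 , 1 , 1) ∷ forward (10 , 3 , 3) ∷ backward (7 , 2 , 2) ∷
  forward (4 , 1 , 1) ∷ backward (5 , 2 , 2) ∷ forward (5 , 1 , 1) ∷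
  forward (10 , 3 , 2) ∷ forward (4 , 1 , 1) ∷ backward (3 , 1 , 1) ∷ []
B-edges =
  backward (4 , 1 , 1) ∷ forward (6 , 2 , 2) ∷ backward (10 , 3 , 3) ∷
  forward (4 , 1 , 1) ∷ backward (3 , 1 , 1) ∷ forward (3 , 1 , 1) ∷
  forward (9 , 3 , 2) ∷ forward (5 , 1 , 1) ∷ backward (5 , 2 , 2) ∷ []
C₁-edges =
  forward (2 , 0 , 1) ∷ backward (2 , 0 , 1) ∷ forward (4 , 0 , 2) ∷
  forward (7 , 0 , 3) ∷ forward (4 , 0 , 2) ∷ forward (2 , 0 , 1) ∷
  forward (5 , 0 , 2) ∷ backward (2 , 0 , 1) ∷ forward (2 , 0 , 1) ∷ []
C₂-edges =
  backward (4 , 0 , 1) ∷ backward (6 , 0 , 2) ∷ forward (2 , 0 , 1) ∷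
  forward (7 , 0 , 3) ∷ forward (3 , 0 , 1) ∷ backward (3 , 0 , 1) ∷
  forward (4 , 0 , 2) ∷ forward (2 , 0 , 1) ∷ forward (4 , 0 , 2) ∷ []
C₃-edges =
  forward (2 , 0 , 1) ∷ forward (6 , 0 , 3) ∷ backward (4 , 0 , 2) ∷
  forward (2 , 0 , 1) ∷ backward (3 , 0 , 1) ∷ forward (3 , 0 , 2) ∷
  forward (5 , 0 , 3) ∷ forward (2 , 0 , 1) ∷ backward (2 , 0 , 1) ∷ []

A-block : Template (3 , 1 , 1) (10 , 3 , 3) (map shift₁ X) Y
A-block = template A-edges
  (from-yes (correct? (3 , 1 , 1) (10 , 3 , 3) A-edges (map shift₁ X) Y))

B-block : Template (3 , 1 , 1) (10 , 3 , 3) Y (map shift₂ X)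
B-block = template B-edges
  (from-yes (correct? (3 , 1 , 1) (10 , 3 , 3) B-edges Y (map shift₂ X)))

C₁-block : Template (2 , 0 , 1) (7 , 0 , 3) (map drop₁ X) X₁
C₁-block = template C₁-edges
  (from-yes (correct? (2 , 0 , 1) (7 , 0 , 3) C₁-edges (map drop₁ X) X₁))

C₂-block : Template (2 , 0 , 1) (7 , 0 , 3) X₁ X₂
C₂-block = template C₂-edges
  (from-yes (correct? (2 , 0 , 1) (7 , 0 , 3) C₂-edges X₁ X₂))

C₃-block : Template (2 , 0 , 1) (7 , 0 , 3) X₂ (map drop₂ X)
C₃-block = template C₃-edges
  (from-yes (correct? (2 , 0 , 1) (7 , 0 , 3) C₃-edges X₂ (map drop₂ X)))

eval-shift₁ : ∀ i j f → eval (suc i) j f ≡ eval i j (shift₁ f)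
eval-shift₁ i j (v , a , b) = lemma i j v a b
  where
  lemma : ∀ i j v a b → v ℕ.+ ((a ℕ.+ i ℕ.* a) ℕ.+ j ℕ.* b) ≡ (v ℕ.+ a) ℕ.+ (i ℕ.* a ℕ.+ j ℕ.* b)
  lemma = solve-∀

eval-shift₂ : ∀ i j f → eval i (suc j) f ≡ eval i j (shift₂ f)
eval-shift₂ i j (v , a , b) = lemma i j v a b
  where
  lemma : ∀ i j v a b → v ℕ.+ (i ℕ.* a ℕ.+ (b ℕ.+ j ℕ.* b)) ≡ (v ℕ.+ b) ℕ.+ (i ℕ.* a ℕ.+ j ℕ.* b)
  lemma = solve-∀

eval-drop₂ : ∀ j f → eval j 0 f ≡ eval 0 j (drop₂ f)
eval-drop₂ j (v , a , b) = cong (v ℕ.+_) (ℕ.+-identityʳ (j ℕ.* a))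

retype : ∀ {i j i′ j′} {h : Form → Form} → (∀ f → eval i j f ≡ eval i′ j′ (h f)) →
  ∀ {n} (s : Vec Form n) → map (eval i′ j′) (map h s) ≡ map (eval i j) s
retype eval≗ s = trans (sym (map-∘ _ _ s)) (map-cong (sym ∘ eval≗) s)

-- Induction on `i`: each pair A, B lowers `i` and raises `j`, so `i + j`, and with it `q` and the
-- final triple, stays fixed. For `j = 0` the chain is closed.
path : ∀ q i j → i ℕ.+ j ℕ.+ 2 ≡ q →
  Chain q (i ℕ.* 2 ℕ.+ 3) (map (eval i j) X) (map (eval (i ℕ.+ j) 0) X)
path q zero j refl =
  subst (λ s → Block (j ℕ.+ 2) s (map (eval 0 j) X₁))
    (retype {0} {j} {0} {j} {drop₁} (λ _ → refl) X)
    (instantiate 0 j C₁-block (lo≡ j) (hi≡ j)) ∷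
  instantiate 0 j C₂-block (lo≡ j) (hi≡ j) ∷
  subst (Block (j ℕ.+ 2) (map (eval 0 j) X₂))
    (retype {j} {0} {0} {j} {drop₂} (eval-drop₂ j) X)
    (instantiate 0 j C₃-block (lo≡ j) (hi≡ j)) ∷
  []
  where
  lo≡ : ∀ j → 2 ℕ.+ (0 ℕ.+ j ℕ.* 1) ≡ j ℕ.+ 2
  lo≡ = solve-∀
  hi≡ : ∀ j → 7 ℕ.+ (0 ℕ.+ j ℕ.* 3) ≡ 3 ℕ.* (j ℕ.+ 2) ℕ.+ 1
  hi≡ = solve-∀
path q (suc i) j refl =
  subst (λ s → Block (suc i ℕ.+ j ℕ.+ 2) s (map (eval i j) Y))
    (retype {suc i} {j} {i} {j} {shift₁} (eval-shift₁ i j) X)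
    (instantiate i j A-block (lo≡ i j) (hi≡ i j)) ∷
  subst (Block (suc i ℕ.+ j ℕ.+ 2) (map (eval i j) Y))
    (retype {i} {suc j} {i} {j} {shift₂} (eval-shift₂ i j) X)
    (instantiate i j B-block (lo≡ i j) (hi≡ i j)) ∷
  subst (λ k → Chain q (i ℕ.* 2 ℕ.+ 3) (map (eval i (suc j)) X) (map (eval k 0) X)) (ℕ.+-suc i j)
    (path q i (suc j) (cong (ℕ._+ 2) (ℕ.+-suc i j)))
  where
  lo≡ : ∀ i j → 3 ℕ.+ (i ℕ.* 1 ℕ.+ j ℕ.* 1) ≡ suc i ℕ.+ j ℕ.+ 2
  lo≡ = solve-∀
  hi≡ : ∀ i j → 10 ℕ.+ (i ℕ.* 3 ℕ.+ j ℕ.* 3) ≡ 3 ℕ.* (suc i ℕ.+ j ℕ.+ 2) ℕ.+ 1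
  hi≡ = solve-∀

-- Division of natural numbers by `k + 1`.

module _ (k : ℕ) where

  frac : ℕ → ℚ
  frac m = + m / suc k

  private
    fracᵘ : ℕ → ℚᵘ.ℚᵘ
    fracᵘ m = ℚᵘ.mkℚᵘ (+ m) k

  -- `_/_` reduces to lowest terms, so the identity is proved for unnormalised fractions, where it
  -- is cross-multiplication.
  frac-homo : ∀ m n → frac (m ℕ.+ n) ≡ frac m ℚ.+ frac n
  frac-homo m n = ℚ.toℚᵘ-injective (begin
    ℚ.toℚᵘ (frac (m ℕ.+ n))               ≈⟨ ℚ.toℚᵘ-fromℚᵘ (fracᵘ (m ℕ.+ n)) ⟩
    fracᵘ (m ℕ.+ n)                       ≈⟨ ℚᵘ.*≡* (lemma (+ m) (+ n) (+ suc k)) ⟩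
    fracᵘ m ℚᵘ.+ fracᵘ n                  ≈⟨ ℚᵘ.+-cong (ℚ.toℚᵘ-fromℚᵘ (fracᵘ m)) (ℚ.toℚᵘ-fromℚᵘ (fracᵘ n)) ⟨
    ℚ.toℚᵘ (frac m) ℚᵘ.+ ℚ.toℚᵘ (frac n)  ≈⟨ ℚ.toℚᵘ-homo-+ (frac m) (frac n) ⟨
    ℚ.toℚᵘ (frac m ℚ.+ frac n)            ∎)
    where
    open ℚᵘ.≃-Reasoning
    lemma : ∀ m n q → (m ℤ.+ n) ℤ.* (q ℤ.* q) ≡ (m ℤ.* q ℤ.+ n ℤ.* q) ℤ.* q
    lemma = ℤ.solve-∀

  frac-mono : ∀ {m n} → m ℕ.≤ n → frac m ℚ.≤ frac n
  frac-mono {m} {n} m≤n = ℚ.toℚᵘ-cancel-≤ (begin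
    ℚ.toℚᵘ (frac m)  ≃⟨ ℚ.toℚᵘ-fromℚᵘ (fracᵘ m) ⟩
    fracᵘ m          ≤⟨ ℚᵘ.*≤* (ℤ.*-monoʳ-≤-nonNeg (+ suc k) (ℤ.+≤+ m≤n)) ⟩
    fracᵘ n          ≃⟨ ℚ.toℚᵘ-fromℚᵘ (fracᵘ n) ⟨
    ℚ.toℚᵘ (frac n)  ∎)
    where open ℚᵘ.≤-Reasoning

  frac-* : ∀ m → frac (m ℕ.* suc k) ≡ + m / 1
  frac-* m = ℚ.fromℚᵘ-cong {fracᵘ (m ℕ.* suc k)} {ℚᵘ.mkℚᵘ (+ m) 0}
    (ℚᵘ.*≡* (trans (ℤ.*-identityʳ (+ (m ℕ.* suc k))) (ℤ.pos-* m (suc k))))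

-- From a closed chain to a real flow, and the bound.

p≤q⇒p≤q+ε : ∀ {p q ε} → p ℚ.≤ q → 0ℚ ℚ.< ε → p ℚ.≤ q ℚ.+ ε
p≤q⇒p≤q+ε {p} {q} {ε} p≤q 0<ε = begin
  p          ≤⟨ p≤q ⟩
  q          ≡⟨ ℚ.+-identityʳ q ⟨
  q ℚ.+ 0ℚ   ≤⟨ ℚ.+-monoʳ-≤ q (ℚ.<⇒≤ 0<ε) ⟩
  q ℚ.+ ε    ∎
  where open ℚ.≤-Reasoning

pointwise-≤ : ∀ {x y} → (∀ n → seq x n ℚ.≤ seq y n) → x ≤ y
pointwise-≤ x≤y ε 0<ε = 0 , λ n _ → p≤q⇒p≤q+ε (x≤y n) 0<ε

pointwise-≃ : ∀ {x y} → (∀ n → seq x n ≡ seq y n) → x ≃ y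
pointwise-≃ {x} {y} x≡y =
  pointwise-≤ {x} {y} (λ n → ℚ.≤-reflexive (x≡y n)) ,
  pointwise-≤ {y} {x} (λ n → ℚ.≤-reflexive (sym (x≡y n)))

bound : ℕ → ℚ
bound k = (+ 4 / 1) ℚ.+ (+ 1 / suc k)

-- With `q = k + 1`, the bound is `(4q + 1) / q`; splitting off `q / q = 1` leaves the largest
-- admissible value divided by `q`.
bound-minus-1 : ∀ k → bound k ℚ.- 1ℚ ≡ frac k (3 ℕ.* suc k ℕ.+ 1)
bound-minus-1 k = begin
  ((+ 4 / 1) ℚ.+ frac k 1) ℚ.- 1ℚ
    ≡⟨ cong (λ p → p ℚ.+ frac k 1 ℚ.- 1ℚ) (frac-* k 4) ⟨
  (frac k (4 ℕ.* q) ℚ.+ frac k 1) ℚ.- 1ℚ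
    ≡⟨ cong (ℚ._- 1ℚ) (frac-homo k (4 ℕ.* q) 1) ⟨
  frac k (4 ℕ.* q ℕ.+ 1) ℚ.- 1ℚ
    ≡⟨ cong (λ m → frac k m ℚ.- 1ℚ) (lemma q) ⟩
  frac k ((3 ℕ.* q ℕ.+ 1) ℕ.+ 1 ℕ.* q) ℚ.- 1ℚ
    ≡⟨ cong (ℚ._- 1ℚ) (frac-homo k (3 ℕ.* q ℕ.+ 1) (1 ℕ.* q)) ⟩
  (frac k (3 ℕ.* q ℕ.+ 1) ℚ.+ frac k (1 ℕ.* q)) ℚ.- 1ℚ
    ≡⟨ cong (λ p → (frac k (3 ℕ.* q ℕ.+ 1) ℚ.+ p) ℚ.- 1ℚ) (frac-* k 1) ⟩
  (frac k (3 ℕ.* q ℕ.+ 1) ℚ.+ 1ℚ) ℚ.- 1ℚ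
    ≡⟨ ℚ.+-assoc (frac k (3 ℕ.* q ℕ.+ 1)) 1ℚ (ℚ.- 1ℚ) ⟩
  frac k (3 ℕ.* q ℕ.+ 1) ℚ.+ 0ℚ
    ≡⟨ ℚ.+-identityʳ _ ⟩
  frac k (3 ℕ.* q ℕ.+ 1) ∎
  where
  open ≡-Reasoning
  q = suc k
  lemma : ∀ q → 4 ℕ.* q ℕ.+ 1 ≡ (3 ℕ.* q ℕ.+ 1) ℕ.+ 1 ℕ.* q
  lemma = solve-∀

closedChain⇒flow : ∀ {n s} k → Chain (suc k) (suc n) s s →
  CircularNowhereZeroFlow (Goldberg.graph (suc n)) (fromℚ (bound k))
closedChain⇒flow {n} k c = record
  { orientation  = orientation
  ; value        = flow
  ; value-lower  = λ e → pointwise-≤ {1ℝ} {flow e} λ _ →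
      subst (ℚ._≤ frac k (amount e)) (frac-* k 1)
        (frac-mono k {1 ℕ.* suc k} {amount e}
          (subst (ℕ._≤ amount e) (sym (ℕ.*-identityˡ (suc k))) (proj₁ (admissible e))))
  ; value-upper  = λ e → pointwise-≤ {flow e} {fromℚ (bound k) - 1ℝ} λ _ →
      subst (frac k (amount e) ℚ.≤_) (sym (bound-minus-1 k))
        (frac-mono k {amount e} {3 ℕ.* suc k ℕ.+ 1} (proj₂ (admissible e)))
  ; conservation = λ v → pointwise-≃ {inflow orientation flow v} {outflow orientation flow v} λ m → begin
      seq (inflow orientation flow v) m   ≡⟨ seq-flow proj₂ v m ⟩
      frac k (flowℕ proj₂ v)              ≡⟨ cong (frac k) (conservation v) ⟩
      frac k (flowℕ proj₁ v)              ≡⟨ seq-flow proj₁ v m ⟨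
      seq (outflow orientation flow v) m  ∎
  }
  where
  open ≡-Reasoning
  open Goldberg (suc n) using (Vertex)
  open Graph (Goldberg.graph (suc n)) using (inflow; outflow; arc; E↔Fin) renaming (_≟_ to _≟ⱽ_)
  open Assembly (direction ∘ block c) (value ∘ block c) (lookup ∘ before c) (lookup ∘ after c)
    (λ t e → cong (λ s → lookup s e) (after-prev c t)) (balanced ∘ block c)

  flow : Fin (suc n) × Fin 12 → ℝ
  flow e = fromℚ (frac k (amount e))

  admissible : ∀ e → Admissible (suc k) (amount e)
  admissible (t , e) with splitAt 9 e
  ... | inj₁ e′ = value-admissible (block c t) e′
  ... | inj₂ e′ = join-admissible (block c t) e′

  -- Taking the `m`-th term and scaling by `frac k` both commute with the sum, so the real and the
  -- integer flow through a vertex meet in the same rational sum.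
  seq-flow : ∀ (end : Vertex × Vertex → Vertex) v m →
    seq (collect ℝ-monoid (λ i → does (end (arc orientation (Inverse.from E↔Fin i)) ≟ⱽ v))
      (flow ∘ Inverse.from E↔Fin)) m ≡ frac k (flowℕ end v)
  seq-flow end v m = trans
    (collect-homo ℝ-monoid ℚ-monoid (λ x → seq x m) refl (λ _ _ → refl) at (flow ∘ Inverse.from E↔Fin))
    (sym (collect-homo ℕ-monoid ℚ-monoid (frac k) (frac-* k 0) (frac-homo k) at (amount ∘ Inverse.from E↔Fin)))
    where
    at : Fin (suc n ℕ.* 12) → Bool
    at i = does (end (arc orientation (Inverse.from E↔Fin i)) ≟ⱽ v)

goldberg-flow : ∀ m → CircularNowhereZeroFlow (goldbergSnark (suc m)) (fromℚ (bound (suc m)))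
goldberg-flow m = closedChain⇒flow (suc m)
  -- Here `k = m + 1` and `q = m + 2`; starting from `i = m` and `j = 0` gives `2m + 3 = 2k + 1`
  -- blocks.
  (subst₂ (λ n j → Chain (suc (suc m)) n (map (eval m 0) X) (map (eval j 0) X))
    (length≡ m) (ℕ.+-identityʳ m) (path (suc (suc m)) m 0 (q≡ m)))
  where
  q≡ : ∀ m → m ℕ.+ 0 ℕ.+ 2 ≡ suc (suc m)
  q≡ = solve-∀
  length≡ : ∀ m → m ℕ.* 2 ℕ.+ 3 ≡ suc (2 ℕ.* suc m)
  length≡ = solve-∀

-- Minimality of the circular flow number is stated only against real numbers that are at least 2.
2≤bound : ∀ k → 2ℝ ≤ fromℚ (bound k)
2≤bound k = pointwise-≤ {2ℝ} {fromℚ (bound k)} λ _ →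
  ℚ.≤-trans (ℚ.≤-trans (from-yes (+ 2 / 1 ℚ.≤? + 4 / 1)) (ℚ.≤-reflexive (sym (ℚ.+-identityʳ (+ 4 / 1)))))
    (ℚ.+-monoʳ-≤ (+ 4 / 1) (subst (ℚ._≤ frac k 1) (frac-* k 0) (frac-mono k {0} {1} ℕ.z≤n)))

proposition4p3 : ∀ (k : ℕ) .{{_ : NonZero k}} (φ : ℝ) →
    IsCircularFlowNumber (goldbergSnark k) φ →
    φ ≤ fromℚ ((+ 4 / 1) ℚ.+ (+ 1 / suc k))
proposition4p3 zero {{k≢0}} _ _ = contradiction refl (ℕ.≢-nonZero⁻¹ 0 {{k≢0}})
proposition4p3 (suc m) φ flowNumber =
  IsCircularFlowNumber.least flowNumber (fromℚ (bound (suc m))) (2≤bound (suc m)) (goldberg-flow m)
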